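{- If $\{\langle X_i,\tau_i\rangle\}_{i\in I}$ is a family of compact MV-topological spaces, then their product space $\langle X,\tau_X\rangle$, where $X=\prod_{i\in I}X_i$ and $\tau_X$ is the product MV-topology, is compact.
   Context: On $[0,1]$ put $x\oplus y=\min(x+y,1)$, $x\odot y=\max(x+y-1,0)$, $x^*=1-x$, $x\wedge y=\min(x,y)$; these operations and arbitrary joins $\bigvee$ are extended pointwise to $[0,1]^X$. $\mathbf 0,\mathbf 1$ denote the constant functions $0,1$. An MV-topological space is a pair $\langle X,\tau\rangle$ with $X$ a set and $\tau\subseteq[0,1]^X$ such that $\mathbf 0,\mathbf 1\in\tau$, $\tau$ is closed under arbitrary joins, and $o_1\odot o_2,\ o_1\oplus o_2,\ o_1\wedge o_2\in\tau$ for all $o_1,o_2\in\tau$. Elements of $\tau$ are called open. A covering of $X$ is a subset $\Gamma\subseteq[0,1]^X$ with $\bigvee\Gamma=\mathbf 1$; it is open if $\Gamma\subseteq\tau$. An additive covering is a finite family $(\alpha_k)_{k=1}^n$ (repetitions allowed) of elements of $[0,1]^X$ with $\alpha_1\oplus\cdots\oplus\alpha_n=\mathbf 1$. The space $\langle X,\tau\rangle$ is compact if for every open covering $\Gamma$ there is an additive covering whose members all belong to $\Gamma$ (repetitions allowed). Product MV-topology: on $X=\prod_{i\in I}X_i$ with canonical projections $\pi_i$, $\tau_X$ is the MV-topology with subbase $S=\{\alpha\circ\pi_i\mid i\in I,\ \alpha\in\tau_i\}$, i.e. the smallest MV-topology on $X$ containing $S$ (for $I\neq\varnothing$ its elements are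 exactly the joins of finite combinations of elements of $S$ by $\oplus,\odot,\wedge$). -}

module Defs where

open import Level using (Level; 0ℓ; _⊔_) renaming (suc to lsuc)
open import Axiom.ExcludedMiddle using (ExcludedMiddle)
open import Data.Empty using (⊥-elim)
open import Data.List.Base using (List; foldr)
open import Data.List.Relation.Unary.All using (All)
open import Data.Product using (Σ; ∃; _×_; _,_; proj₁; proj₂)
open import Data.Rational as ℚ using (ℚ; 0ℚ; 1ℚ)
import Data.Rational.Properties as ℚₚ
open import Data.Sum using (_⊎_; inj₁; inj₂; [_,_]′)
open import Relation.Binary.Definitions using (tri<; tri≈; tri>)
open import Relation.Binary.PropositionalEquality using (_≡_; refl; sym; trans; cong; subst)
open import Relation.Nullary using (¬_; Dec)
open import Relation.Nullary.Decidable using (True; toWitness; fromWitness)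
open import Relation.Unary using (Pred; _∈_; _∉_; _⊆_)

-- Dedekind's reals in the one-sided form: a real is identified with the
-- set of rationals strictly below it, an inhabited, proper, downward closed
-- set without greatest element.  No locatedness is required, so these are
-- the usual reals in the presence of excluded middle, which is how they are
-- used below.
record ℝ : Set₁ where
  field
    Below     : Pred ℚ 0ℓ
    inhabited : ∃ λ q → q ∈ Below
    proper    : ∃ λ q → q ∉ Below
    lower     : ∀ {p q} → p ℚ.< q → q ∈ Below → p ∈ Below
    rounded   : ∀ {p} → p ∈ Below → ∃ λ q → p ℚ.< q × q ∈ Below

open ℝ public

infix 4 _≤_

_≤_ : ℝ → ℝ → Set
x ≤ y = Below x ⊆ Below y

private
  lower≤ : (x : ℝ) → ∀ {p q} → p ℚ.≤ q → q ∈ Below x → p ∈ Below x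
  lower≤ x {p} {q} p≤q q∈ with ℚₚ.<-cmp p q
  ... | tri< p<q _ _  = lower x p<q q∈
  ... | tri≈ _ refl _ = q∈
  ... | tri> _ _ q<p  = ⊥-elim (ℚₚ.<-irrefl refl (ℚₚ.<-≤-trans q<p p≤q))

  below< : (x : ℝ) → ∀ {p q} → p ∈ Below x → q ∉ Below x → p ℚ.< q
  below< x {p} {q} p∈ q∉ = ℚₚ.≰⇒> λ q≤p → q∉ (lower≤ x q≤p p∈)

  p-1<p : ∀ p → p ℚ.+ ℚ.- 1ℚ ℚ.< p
  p-1<p p = subst (p ℚ.+ ℚ.- 1ℚ ℚ.<_) (ℚₚ.+-identityʳ p)
                  (ℚₚ.+-monoʳ-< p (toWitness {a? = ℚ.- 1ℚ ℚₚ.<? 0ℚ} _))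

  p-q+q : ∀ p q → (p ℚ.+ ℚ.- q) ℚ.+ q ≡ p
  p-q+q p q = trans (ℚₚ.+-assoc p (ℚ.- q) q)
             (trans (cong (p ℚ.+_) (ℚₚ.+-inverseˡ q)) (ℚₚ.+-identityʳ p))

  p+q-q : ∀ p q → (p ℚ.+ q) ℚ.+ ℚ.- q ≡ p
  p+q-q p q = trans (ℚₚ.+-assoc p q (ℚ.- q))
             (trans (cong (p ℚ.+_) (ℚₚ.+-inverseʳ q)) (ℚₚ.+-identityʳ p))

fromℚ : ℚ → ℝ
fromℚ r .Below p   = p ℚ.< r
fromℚ r .inhabited = r ℚ.+ ℚ.- 1ℚ , p-1<p r
fromℚ r .proper    = r , ℚₚ.<-irrefl refl
fromℚ r .lower     = ℚₚ.<-trans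
fromℚ r .rounded   = ℚₚ.<-dense

0ℝ 1ℝ -1ℝ : ℝ
0ℝ  = fromℚ 0ℚ
1ℝ  = fromℚ 1ℚ
-1ℝ = fromℚ (ℚ.- 1ℚ)

infixl 6 _+_

_+_ : ℝ → ℝ → ℝ
(x + y) .Below r = ∃ λ p → ∃ λ q → p ∈ Below x × q ∈ Below y × r ≡ p ℚ.+ q
(x + y) .inhabited with inhabited x | inhabited y
... | p , p∈ | q , q∈ = p ℚ.+ q , p , q , p∈ , q∈ , refl
(x + y) .proper with proper x | proper y
... | a , a∉ | b , b∉ = a ℚ.+ b , λ where
  (p , q , p∈ , q∈ , a+b≡p+q) →
    ℚₚ.<-irrefl (sym a+b≡p+q) (ℚₚ.+-mono-< (below< x p∈ a∉) (below< y q∈ b∉))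
(x + y) .lower {s} s<r (p , q , p∈ , q∈ , refl) =
  s ℚ.+ ℚ.- q , q ,
  lower x (subst (s ℚ.+ ℚ.- q ℚ.<_) (p+q-q p q) (ℚₚ.+-monoˡ-< (ℚ.- q) s<r)) p∈ ,
  q∈ , sym (p-q+q s q)
(x + y) .rounded (p , q , p∈ , q∈ , refl) with rounded x p∈
... | p′ , p<p′ , p′∈ = p′ ℚ.+ q , ℚₚ.+-monoˡ-< q p<p′ , p′ , q , p′∈ , q∈ , refl

min : ℝ → ℝ → ℝ
min x y .Below p = p ∈ Below x × p ∈ Below y
min x y .inhabited with inhabited x | inhabited y
... | p , p∈ | q , q∈ with ℚₚ.≤-total p q
...   | inj₁ p≤q = p , p∈ , lower≤ y p≤q q∈
...   | inj₂ q≤p = q , lower≤ x q≤p p∈ , q∈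
min x y .proper with proper x
... | p , p∉ = p , λ p∈ → p∉ (proj₁ p∈)
min x y .lower p<q (q∈x , q∈y) = lower x p<q q∈x , lower y p<q q∈y
min x y .rounded (p∈x , p∈y) with rounded x p∈x | rounded y p∈y
... | q , p<q , q∈ | r , p<r , r∈ with ℚₚ.≤-total q r
...   | inj₁ q≤r = q , p<q , q∈ , lower≤ y q≤r r∈
...   | inj₂ r≤q = r , p<r , lower≤ x r≤q q∈ , r∈

max : ℝ → ℝ → ℝ
max x y .Below p = p ∈ Below x ⊎ p ∈ Below y
max x y .inhabited with inhabited x
... | p , p∈ = p , inj₁ p∈
max x y .proper with proper x | proper y
... | p , p∉ | q , q∉ with ℚₚ.≤-total p q
...   | inj₁ p≤q = q , [ (λ q∈ → p∉ (lower≤ x p≤q q∈)) , q∉ ]′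
...   | inj₂ q≤p = p , [ p∉ , (λ p∈ → q∉ (lower≤ y q≤p p∈)) ]′
max x y .lower p<q (inj₁ q∈) = inj₁ (lower x p<q q∈)
max x y .lower p<q (inj₂ q∈) = inj₂ (lower y p<q q∈)
max x y .rounded (inj₁ p∈) with rounded x p∈
... | q , p<q , q∈ = q , p<q , inj₁ q∈
max x y .rounded (inj₂ p∈) with rounded y p∈
... | q , p<q , q∈ = q , p<q , inj₂ q∈

private
  0≤+ : ∀ x y → 0ℝ ≤ x → 0ℝ ≤ y → 0ℝ ≤ x + y
  0≤+ x y 0≤x 0≤y {r} r<0 with ℚₚ.<-dense r<0
  ... | s , r<s , s<0 =
    r ℚ.+ ℚ.- s , s ,
    0≤x (subst (r ℚ.+ ℚ.- s ℚ.<_) (ℚₚ.+-inverseʳ s) (ℚₚ.+-monoˡ-< (ℚ.- s) r<s)) ,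
    0≤y s<0 , sym (p-q+q r s)

  0≤1 : 0ℝ ≤ 1ℝ
  0≤1 p<0 = ℚₚ.<-trans p<0 (toWitness {a? = 0ℚ ℚₚ.<? 1ℚ} _)

  +-1≤1 : ∀ x y → x ≤ 1ℝ → y ≤ 1ℝ → x + y + -1ℝ ≤ 1ℝ
  +-1≤1 x y x≤1 y≤1 (_ , c , (a , b , a∈ , b∈ , refl) , c<-1 , refl) =
    ℚₚ.+-mono-< (ℚₚ.+-mono-< (x≤1 a∈) (y≤1 b∈)) c<-1

record 𝕀 : Set₁ where
  field
    value : ℝ
    0≤    : 0ℝ ≤ value
    ≤1    : value ≤ 1ℝ

open 𝕀 public

infix 4 _≤ᴵ_ _≈ᴵ_

_≤ᴵ_ _≈ᴵ_ : 𝕀 → 𝕀 → Set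
r ≤ᴵ s = value r ≤ value s
r ≈ᴵ s = r ≤ᴵ s × s ≤ᴵ r

0ᴵ 1ᴵ : 𝕀
0ᴵ = record { value = 0ℝ ; 0≤ = λ p → p ; ≤1 = 0≤1 }
1ᴵ = record { value = 1ℝ ; 0≤ = 0≤1 ; ≤1 = λ p → p }

infixl 6 _⊕ᴵ_
infixl 7 _⊙ᴵ_ _∧ᴵ_

_⊕ᴵ_ _⊙ᴵ_ _∧ᴵ_ : 𝕀 → 𝕀 → 𝕀

(r ⊕ᴵ s) .value = min (value r + value s) 1ℝ
(r ⊕ᴵ s) .0≤ p  = 0≤+ (value r) (value s) (0≤ r) (0≤ s) p , 0≤1 p
(r ⊕ᴵ s) .≤1    = proj₂

(r ⊙ᴵ s) .value = max (value r + value s + -1ℝ) 0ℝ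
(r ⊙ᴵ s) .0≤    = inj₂
(r ⊙ᴵ s) .≤1    = [ +-1≤1 (value r) (value s) (≤1 r) (≤1 s) , 0≤1 ]′

(r ∧ᴵ s) .value = min (value r) (value s)
(r ∧ᴵ s) .0≤ p  = 0≤ r p , 0≤ s p
(r ∧ᴵ s) .≤1 p  = ≤1 r (proj₁ p)

-- Suprema are a relation, because the union of a family of cuts need not
-- lie in the universe of the cuts themselves; sup-exists shows that
-- classically nothing is lost.
IsSup : ∀ {g} → Pred 𝕀 g → 𝕀 → Set (lsuc 0ℓ ⊔ g)
IsSup S s = (∀ r → r ∈ S → r ≤ᴵ s)
          × (∀ u → (∀ r → r ∈ S → r ≤ᴵ u) → s ≤ᴵ u)

sup-exists : ∀ {g} → ExcludedMiddle (lsuc 0ℓ ⊔ g) → (S : Pred 𝕀 g) → ∃ (IsSup S)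
sup-exists {g} em S = s , upper , least
  where
  U : Pred ℚ (lsuc 0ℓ ⊔ g)
  U p = p ℚ.< 0ℚ ⊎ Σ 𝕀 λ r → r ∈ S × p ∈ Below (value r)

  U? : ∀ p → Dec (U p)
  U? p = em

  U<1 : ∀ {p} → U p → p ℚ.< 1ℚ
  U<1 (inj₁ p<0)            = 0≤1 p<0
  U<1 (inj₂ (r , _ , p∈))   = ≤1 r p∈

  U-lower : ∀ {p q} → p ℚ.< q → U q → U p
  U-lower p<q (inj₁ q<0)             = inj₁ (ℚₚ.<-trans p<q q<0)
  U-lower p<q (inj₂ (r , r∈S , q∈))  = inj₂ (r , r∈S , lower (value r) p<q q∈)

  U-rounded : ∀ {p} → U p → ∃ λ q → p ℚ.< q × U q
  U-rounded (inj₁ p<0) with ℚₚ.<-dense p<0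
  ... | q , p<q , q<0 = q , p<q , inj₁ q<0
  U-rounded (inj₂ (r , r∈S , p∈)) with rounded (value r) p∈
  ... | q , p<q , q∈ = q , p<q , inj₂ (r , r∈S , q∈)

  cut : ℝ
  cut .Below p      = True (U? p)
  cut .inhabited    = 0ℚ ℚ.+ ℚ.- 1ℚ , fromWitness (inj₁ (p-1<p 0ℚ))
  cut .proper       = 1ℚ , λ t → ℚₚ.<-irrefl refl (U<1 (toWitness t))
  cut .lower p<q t  = fromWitness (U-lower p<q (toWitness t))
  cut .rounded t with U-rounded (toWitness t)
  ... | q , p<q , u = q , p<q , fromWitness u

  s : 𝕀
  s = record { value = cut ; 0≤ = λ p<0 → fromWitness (inj₁ p<0) ; ≤1 = λ t → U<1 (toWitness t) }

  upper : ∀ r → r ∈ S → r ≤ᴵ s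
  upper r r∈S p∈ = fromWitness (inj₂ (r , r∈S , p∈))

  least : ∀ u → (∀ r → r ∈ S → r ≤ᴵ u) → s ≤ᴵ u
  least u bound t = [ 0≤ u , (λ (r , r∈S , p∈) → bound r r∈S p∈) ]′ (toWitness t)

𝕀^_ : ∀ {x} → Set x → Set (lsuc 0ℓ ⊔ x)
𝕀^ X = X → 𝕀

module _ {x : Level} {X : Set x} where

  infix 4 _≈_

  _≈_ : 𝕀^ X → 𝕀^ X → Set x
  α ≈ β = ∀ a → α a ≈ᴵ β a

  𝟎 𝟏 : 𝕀^ X
  𝟎 _ = 0ᴵ
  𝟏 _ = 1ᴵ

  infixl 6 _⊕_
  infixl 7 _⊙_ _∧_

  _⊕_ _⊙_ _∧_ : 𝕀^ X → 𝕀^ X → 𝕀^ X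
  (α ⊕ β) a = α a ⊕ᴵ β a
  (α ⊙ β) a = α a ⊙ᴵ β a
  (α ∧ β) a = α a ∧ᴵ β a

  -- Read  IsJoin Γ o  as  ⋁ Γ = o.
  IsJoin : ∀ {g} → Pred (𝕀^ X) g → 𝕀^ X → Set (lsuc 0ℓ ⊔ x ⊔ g)
  IsJoin Γ o = ∀ a → IsSup (λ r → ∃ λ α → α ∈ Γ × r ≡ α a) (o a)

-- g is the universe of the sets Γ of fuzzy subsets that are quantified over.
-- Membership in τ respects ≈ because elements of [0,1] are cuts up to _≈ᴵ_.
record IsMVTopology {x t : Level} (g : Level) {X : Set x} (τ : Pred (𝕀^ X) t)
       : Set (lsuc 0ℓ ⊔ x ⊔ t ⊔ lsuc g) where
  field
    respects-≈ : ∀ {o o′} → o ≈ o′ → o ∈ τ → o′ ∈ τ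
    𝟎-open     : 𝟎 ∈ τ
    𝟏-open     : 𝟏 ∈ τ
    ⋁-open     : (Γ : Pred (𝕀^ X) g) → Γ ⊆ τ → ∀ {o} → IsJoin Γ o → o ∈ τ
    ⊙-open     : ∀ {o₁ o₂} → o₁ ∈ τ → o₂ ∈ τ → o₁ ⊙ o₂ ∈ τ
    ⊕-open     : ∀ {o₁ o₂} → o₁ ∈ τ → o₂ ∈ τ → o₁ ⊕ o₂ ∈ τ
    ∧-open     : ∀ {o₁ o₂} → o₁ ∈ τ → o₂ ∈ τ → o₁ ∧ o₂ ∈ τ

record MVTopologicalSpace (x t g : Level) : Set (lsuc (lsuc 0ℓ ⊔ x ⊔ t ⊔ g)) where
  field
    Point        : Set x
    Open         : Pred (𝕀^ Point) t
    isMVTopology : IsMVTopology g Open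

  open IsMVTopology isMVTopology public

open MVTopologicalSpace public using (Point; Open)

IsCovering : ∀ {x g} {X : Set x} → Pred (𝕀^ X) g → Set (lsuc 0ℓ ⊔ x ⊔ g)
IsCovering Γ = IsJoin Γ 𝟏

-- Finite families are lists; the empty sum is 𝟎, so the empty family is an
-- additive covering only of the empty set.
IsAdditiveCovering : ∀ {x} {X : Set x} → List (𝕀^ X) → Set x
IsAdditiveCovering αs = foldr _⊕_ 𝟎 αs ≈ 𝟏

Compact : ∀ {x t g} → MVTopologicalSpace x t g → Set (lsuc 0ℓ ⊔ x ⊔ t ⊔ lsuc g)
Compact {g = g} X =
  (Γ : Pred (𝕀^ Point X) g) → Γ ⊆ Open X → IsCovering Γ →
  ∃ λ αs → All (_∈ Γ) αs × IsAdditiveCovering αs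

data Generated {x s : Level} (g : Level) {X : Set x} (S : Pred (𝕀^ X) s)
     : Pred (𝕀^ X) (lsuc 0ℓ ⊔ x ⊔ s ⊔ lsuc g) where
  subbasic : ∀ {o} → o ∈ S → Generated g S o
  respects : ∀ {o o′} → o ≈ o′ → Generated g S o → Generated g S o′
  zero     : Generated g S 𝟎
  one      : Generated g S 𝟏
  join     : (Γ : Pred (𝕀^ X) g) → (∀ {α} → α ∈ Γ → Generated g S α) →
             ∀ {o} → IsJoin Γ o → Generated g S o
  times    : ∀ {o₁ o₂} → Generated g S o₁ → Generated g S o₂ → Generated g S (o₁ ⊙ o₂)
  plus     : ∀ {o₁ o₂} → Generated g S o₁ → Generated g S o₂ → Generated g S (o₁ ⊕ o₂)
  meet     : ∀ {o₁ o₂} → Generated g S o₁ → Generated g S o₂ → Generated g S (o₁ ∧ o₂)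

module _ {x s g : Level} {X : Set x} {S : Pred (𝕀^ X) s} where

  generated-isMVTopology : IsMVTopology g (Generated g S)
  generated-isMVTopology = record
    { respects-≈ = respects
    ; 𝟎-open     = zero
    ; 𝟏-open     = one
    ; ⋁-open     = join
    ; ⊙-open     = times
    ; ⊕-open     = plus
    ; ∧-open     = meet
    }

  generated-smallest : ∀ {t} {τ : Pred (𝕀^ X) t} →
                       IsMVTopology g τ → S ⊆ τ → Generated g S ⊆ τ
  generated-smallest {τ = τ} T S⊆τ = go
    where
    open IsMVTopology T

    go : Generated g S ⊆ τ
    go (subbasic o∈S)      = S⊆τ o∈S
    go (respects o≈o′ o∈)  = respects-≈ o≈o′ (go o∈)
    go zero                = 𝟎-open
    go one                 = 𝟏-open
    go (join Γ Γ⊆ o=⋁Γ)    = ⋁-open Γ (λ α∈Γ → go (Γ⊆ α∈Γ)) o=⋁Γ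
    go (times p q)         = ⊙-open (go p) (go q)
    go (plus p q)          = ⊕-open (go p) (go q)
    go (meet p q)          = ∧-open (go p) (go q)

module _ {i x t g : Level} {I : Set i} (X : I → MVTopologicalSpace x t g) where

  productSubbase : Pred (𝕀^ (∀ j → Point (X j))) (lsuc 0ℓ ⊔ i ⊔ x ⊔ t)
  productSubbase o = ∃ λ j → ∃ λ α → α ∈ Open (X j) × o ≡ (λ a → α (a j))

  Product : MVTopologicalSpace (i ⊔ x) (lsuc 0ℓ ⊔ i ⊔ x ⊔ t ⊔ lsuc g) g
  Product = record
    { Point        = ∀ j → Point (X j)
    ; Open         = Generated g productSubbase
    ; isMVTopology = generated-isMVTopology
    }

{-# OPTIONS --safe #-}

-- By excluded middle and Zorn's lemma there is, if Γ has no additive subcovering,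
-- a prime filter F of subsets of the product containing no set {α > p} with α ∈ Γ
-- and p > 0: if finitely many of these sets covered the product, sufficiently many
-- copies of the corresponding α would add up to 𝟏.  Compactness of X j yields a
-- point y j to which F converges, in the sense that {a | α (a j) > r} ∈ F whenever
-- α is open and α (y j) > r.  The same then holds at y for every open set of the
-- product, because {o > r} for o a join or a ⊕, ⊙, ∧ of opens is a union of finite
-- intersections of such sets.  As Γ covers y, some α ∈ Γ has α y > ½, so that
-- {α > ½} ∈ F, a contradiction.
module Submission where

open import Defs
open import Axiom.ExcludedMiddle using (ExcludedMiddle)
open import Axiom.Extensionality.Propositional using (Extensionality)
open import Data.Bool.Base using (Bool; true; false; T)
open import Data.Empty using (⊥-elim)
open import Data.Integer.Base as ℤ using (+_)
import Data.Integer.Properties as ℤ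
import Data.Integer.Solver as ℤ
open import Data.List.Base using (List; []; _∷_; _++_; foldr; replicate)
open import Data.List.Relation.Unary.All as All using (All; []; _∷_)
import Data.List.Relation.Unary.All.Properties as All
open import Data.List.Relation.Unary.Any as Any using (Any; here; there)
import Data.List.Relation.Unary.Any.Properties as Any
open import Data.Nat.Base using (zero; suc; s≤s; z≤n)
open import Data.Product using (∃; _×_; _,_; proj₁; proj₂)
open import Data.Rational as ℚ using (ℚ; mkℚ; 0ℚ; 1ℚ; ½)
import Data.Rational.Properties as ℚ
open import Data.Rational.Solver using (module +-*-Solver)
import Data.Rational.Unnormalised as ℚᵘ
import Data.Rational.Unnormalised.Properties as ℚᵘ
open import Data.Sum using (_⊎_; inj₁; inj₂; [_,_]′)
open import Data.Unit.Base using (tt)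
open import Function.Base using (_∘_)
open import Level using (0ℓ; _⊔_; Lift; lift) renaming (suc to lsuc)
open import Relation.Binary.PropositionalEquality using (_≡_; refl; subst; subst₂)
open import Relation.Nullary using (¬_; yes; no)
open import Relation.Nullary.Decidable using (True; ⌊_⌋; toWitness; fromWitness; decidable-stable)
open import Relation.Unary using (Pred; _∈_; _∉_; _⊆_; _∪_; _∩_; U; ∅)
open import Algebra.Definitions.RawMonoid ℚ.+-0-rawMonoid using () renaming (_×_ to _·_)
open +-*-Solver using (solve; _:+_; _:-_; :-_; _:=_; con)

-- Rational arithmetic

-- The denominator of `q` serves: as the numerator is positive, `q` is at least `1 / suc d`, so
-- `suc d` copies reach `1`.
archimedean : ∀ {q} → 0ℚ ℚ.< q → ∃ λ n → 1ℚ ℚ.≤ suc n · q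
archimedean {mkℚ (ℤ.-[1+ _ ]) _ _} (ℚ.*<* ())
archimedean {mkℚ (+ zero) _ _} (ℚ.*<* (ℤ.+<+ ()))
archimedean {q@(mkℚ (+ suc a) d _)} _ = d , ℚ.toℚᵘ-cancel-≤ (ℚᵘ.≤-trans 1≤d/d (bound (suc d)))
  where
  open ℤ.+-*-Solver using ()
    renaming (solve to solveℤ; _:+_ to _⊞_; _:*_ to _⊠_; _:=_ to _⊜_; con to conℤ)

  1/d≤q : ℚᵘ.mkℚᵘ (+ 1) d ℚᵘ.≤ ℚ.toℚᵘ q
  1/d≤q = ℚᵘ.*≤* (ℤ.*-monoʳ-≤-nonNeg (+ suc d) {+ 1} {+ suc a} (ℤ.+≤+ (s≤s z≤n)))

  bound : ∀ k → ℚᵘ.mkℚᵘ (+ k) d ℚᵘ.≤ ℚ.toℚᵘ (k · q)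
  bound zero    = ℚᵘ.≤-reflexive (ℚᵘ.*≡* refl)
  bound (suc k) = begin
    ℚᵘ.mkℚᵘ (+ suc k) d                    ≃⟨ ℚᵘ.*≡* (solveℤ 2 (λ k D →
      (conℤ (+ 1) ⊞ k) ⊠ (D ⊠ D) ⊜ (conℤ (+ 1) ⊠ D ⊞ k ⊠ D) ⊠ D) refl (+ k) (+ suc d)) ⟩
    ℚᵘ.mkℚᵘ (+ 1) d ℚᵘ.+ ℚᵘ.mkℚᵘ (+ k) d   ≤⟨ ℚᵘ.+-mono-≤ {ℚᵘ.mkℚᵘ (+ 1) d} {ℚ.toℚᵘ q} 1/d≤q (bound k) ⟩
    ℚ.toℚᵘ q ℚᵘ.+ ℚ.toℚᵘ (k · q)           ≃⟨ ℚ.toℚᵘ-homo-+ q (k · q) ⟨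
    ℚ.toℚᵘ (suc k · q)                     ∎
    where open ℚᵘ.≤-Reasoning

  1≤d/d : ℚ.toℚᵘ 1ℚ ℚᵘ.≤ ℚᵘ.mkℚᵘ (+ suc d) d
  1≤d/d = ℚᵘ.≤-reflexive (ℚᵘ.*≡*
    (solveℤ 1 (λ D → conℤ (+ 1) ⊠ D ⊜ D ⊠ conℤ (+ 1)) refl (+ suc d)))

m·q≤m·[q+q] : ∀ m {q} → 0ℚ ℚ.≤ q → m · q ℚ.≤ m · (q ℚ.+ q)
m·q≤m·[q+q] zero        0≤q = ℚ.≤-refl
m·q≤m·[q+q] (suc m) {q} 0≤q = ℚ.+-mono-≤ (p≤p+q q 0≤q) (m·q≤m·[q+q] m 0≤q)
  where
  p≤p+q : ∀ p {q} → 0ℚ ℚ.≤ q → p ℚ.≤ p ℚ.+ q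
  p≤p+q p {q} 0≤q = subst (ℚ._≤ p ℚ.+ q) (ℚ.+-identityʳ p) (ℚ.+-monoʳ-≤ p 0≤q)

-- Doubling the gap saves a copy, which lets the count in `separate-gap` go down by one.
double-· : ∀ m {q} → 0ℚ ℚ.≤ q → suc (suc m) · q ℚ.≤ suc m · (q ℚ.+ q)
double-· m {q} 0≤q = subst (ℚ._≤ suc m · (q ℚ.+ q)) (ℚ.+-assoc q q (m · q))
  (ℚ.+-monoʳ-≤ (q ℚ.+ q) (m·q≤m·[q+q] m 0≤q))

average : ∀ {r} p q → r ℚ.+ r ℚ.≤ p ℚ.+ q → r ℚ.≤ p ⊎ r ℚ.≤ q
average {r} p q 2r≤p+q with r ℚ.≤? p | r ℚ.≤? q
... | yes r≤p | _       = inj₁ r≤p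
... | no _    | yes r≤q = inj₂ r≤q
... | no r≰p  | no r≰q  =
  ⊥-elim (ℚ.<-irrefl refl (ℚ.≤-<-trans 2r≤p+q (ℚ.+-mono-< (ℚ.≰⇒> r≰p) (ℚ.≰⇒> r≰q))))

-- Doubling in the unit interval and separation by open sets

infix 4 _<ᴵ_

_<ᴵ_ : ℚ → 𝕀 → Set
p <ᴵ a = p ∈ Below (value a)

≤-<ᴵ-trans : ∀ a {p q} → p ℚ.≤ q → q <ᴵ a → p <ᴵ a
≤-<ᴵ-trans a {p} {q} p≤q q<a with q ℚ.≤? p
... | yes q≤p = subst (_<ᴵ a) (ℚ.≤-antisym q≤p p≤q) q<a
... | no  q≰p = lower (value a) (ℚ.≰⇒> q≰p) q<a

⊕-double-elim : ∀ a {r} → r ℚ.+ r <ᴵ a ⊕ᴵ a → r <ᴵ a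
⊕-double-elim a ((p , q , p<a , q<a , 2r≡p+q) , _) with average p q (ℚ.≤-reflexive 2r≡p+q)
... | inj₁ r≤p = ≤-<ᴵ-trans a r≤p p<a
... | inj₂ r≤q = ≤-<ᴵ-trans a r≤q q<a

-- The hypothesis `0 ≤ u` rules out truncation at `0`; what remains bounds a sum of two rationals
-- below `a`, and `average` picks one of them.
⊙-double-elim : ∀ a {r u} → 0ℚ ℚ.≤ u → r ℚ.+ r ℚ.≤ u ℚ.+ 1ℚ → u <ᴵ a ⊙ᴵ a → r <ᴵ a
⊙-double-elim a 0≤u _ (inj₂ u<0) = ⊥-elim (ℚ.<-irrefl refl (ℚ.<-≤-trans u<0 0≤u))
⊙-double-elim a {r} 0≤u 2r≤u+1 (inj₁ (_ , c , (p , q , p<a , q<a , refl) , c<-1 , refl))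
  with average p q (ℚ.≤-trans 2r≤u+1 (ℚ.<⇒≤ u+1<p+q))
  where
  u+1<p+q : p ℚ.+ q ℚ.+ c ℚ.+ 1ℚ ℚ.< p ℚ.+ q
  u+1<p+q = subst (p ℚ.+ q ℚ.+ c ℚ.+ 1ℚ ℚ.<_)
    (solve 1 (λ x → x :+ con (ℚ.- 1ℚ) :+ con 1ℚ := x) refl (p ℚ.+ q))
    (ℚ.+-monoˡ-< 1ℚ (ℚ.+-monoʳ-< (p ℚ.+ q) c<-1))
... | inj₁ r≤p = ≤-<ᴵ-trans a r≤p p<a
... | inj₂ r≤q = ≤-<ᴵ-trans a r≤q q<a

⊙-double-intro : ∀ a {t u} → t <ᴵ a → u ℚ.+ 1ℚ ℚ.< t ℚ.+ t → u <ᴵ a ⊙ᴵ a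
⊙-double-intro a {t} {u} t<a u+1<2t = inj₁
  ( t ℚ.+ t , u ℚ.- (t ℚ.+ t) , (t , t , t<a , t<a , refl)
  , subst₂ ℚ._<_
      (solve 2 (λ u s → (u :+ con 1ℚ) :+ (:- s :+ con (ℚ.- 1ℚ)) := u :- s) refl u (t ℚ.+ t))
      (solve 1 (λ s → s :+ (:- s :+ con (ℚ.- 1ℚ)) := con (ℚ.- 1ℚ)) refl (t ℚ.+ t))
      (ℚ.+-monoˡ-< (ℚ.- (t ℚ.+ t) ℚ.+ ℚ.- 1ℚ) u+1<2t)
  , solve 2 (λ u s → u := s :+ (u :- s)) refl u (t ℚ.+ t) )

0<1 : 0ℚ ℚ.< 1ℚ
0<1 = toWitness {a? = 0ℚ ℚ.<? 1ℚ} _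

module _ {x t g} {X : Set x} {τ : Pred (𝕀^ X) t} (T : IsMVTopology g τ) where
  open IsMVTopology T

  -- Doubling by ⊕ below ½ and by ⊙ above ½ doubles the gap δ, until r < 0.
  separate-gap : ∀ n {α} r {δ} y → α ∈ τ → 0ℚ ℚ.< δ → 1ℚ ℚ.≤ suc n · δ → r ℚ.+ δ <ᴵ α y →
             ∃ λ β → β ∈ τ × 0ℚ <ᴵ β y × (∀ z → 0ℚ <ᴵ β z → r <ᴵ α z)
  separate-gap zero {α} r {δ} y _ _ 1≤δ r+δ<α = 𝟏 , 𝟏-open , 0<1 , λ z _ → 0≤ (α z) r<0
    where
    r<0 : r ℚ.< 0ℚ
    r<0 = subst₂ ℚ._<_
      (solve 2 (λ r δ → (r :+ δ) :- δ := r) refl r δ)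
      (solve 1 (λ δ → (δ :+ con 0ℚ) :- δ := con 0ℚ) refl δ)
      (ℚ.+-monoˡ-< (ℚ.- δ) (ℚ.<-≤-trans (≤1 (α y) r+δ<α) 1≤δ))
  separate-gap (suc m) {α} r {δ} y α∈τ 0<δ 1≤nδ r+δ<α with r ℚ.+ δ ℚ.<? ½ | r ℚ.<? ½
  ... | yes r+δ<½ | _ =
    let β , β∈τ , 0<β , sep = separate-gap m (r ℚ.+ r) {δ ℚ.+ δ} y (⊕-open α∈τ α∈τ)
                                (ℚ.+-mono-< 0<δ 0<δ) (ℚ.≤-trans 1≤nδ (double-· m (ℚ.<⇒≤ 0<δ)))
                                (subst (_<ᴵ α y ⊕ᴵ α y)
                                  (solve 2 (λ r d → (r :+ d) :+ (r :+ d) := (r :+ r) :+ (d :+ d)) refl r δ)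
                                  ((_ , _ , r+δ<α , r+δ<α , refl) , ℚ.+-mono-< r+δ<½ r+δ<½))
    in β , β∈τ , 0<β , λ z p → ⊕-double-elim (α z) (sep z p)
  ... | no r+δ≮½ | yes r<½ =
    α ⊙ α , ⊙-open α∈τ α∈τ ,
    (let s , r+δ<s , s<α = rounded (value (α y)) r+δ<α
         ½<s = ℚ.≤-<-trans (ℚ.≮⇒≥ r+δ≮½) r+δ<s
     in ⊙-double-intro (α y) s<α (ℚ.+-mono-< ½<s ½<s)) ,
    λ z → ⊙-double-elim (α z) ℚ.≤-refl (ℚ.<⇒≤ (ℚ.+-mono-< r<½ r<½))
  ... | no r+δ≮½ | no r≮½ =
    -- The map `v ↦ 2v - 1` sends `r` to `r′` and `r + δ` to `r′ + (δ + δ)`; `s` provides the strict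
    -- inequality that `⊙-double-intro` asks for.
    let r′ = r ℚ.+ r ℚ.- 1ℚ
        s , r+δ<s , s<α = rounded (value (α y)) r+δ<α
        β , β∈τ , 0<β , sep = separate-gap m r′ {δ ℚ.+ δ} y (⊙-open α∈τ α∈τ)
                                (ℚ.+-mono-< 0<δ 0<δ) (ℚ.≤-trans 1≤nδ (double-· m (ℚ.<⇒≤ 0<δ)))
                                (⊙-double-intro (α y) s<α
                                  (subst (ℚ._< s ℚ.+ s)
                                    (solve 2 (λ r d → (r :+ d) :+ (r :+ d) :=
                                      ((r :+ r) :- con 1ℚ) :+ (d :+ d) :+ con 1ℚ) refl r δ)
                                    (ℚ.+-mono-< r+δ<s r+δ<s)))
    in β , β∈τ , 0<β , λ z p → ⊙-double-elim (α z)
         (ℚ.+-monoˡ-≤ (ℚ.- 1ℚ) (ℚ.+-mono-≤ (ℚ.≮⇒≥ r≮½) (ℚ.≮⇒≥ r≮½)))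
         (ℚ.≤-reflexive (solve 1 (λ x → x := x :- con 1ℚ :+ con 1ℚ) refl (r ℚ.+ r)))
         (sep z p)

  -- Reduces every level `r` to level `0`, the only one that `Null` tests. The initial gap `s - r`
  -- comes from roundedness of the cut, the number of doublings from `archimedean`.
  open-separation : ∀ {α} r y → α ∈ τ → r <ᴵ α y →
                    ∃ λ β → β ∈ τ × 0ℚ <ᴵ β y × (∀ z → 0ℚ <ᴵ β z → r <ᴵ α z)
  open-separation {α} r y α∈τ r<α with rounded (value (α y)) r<α
  ... | s , r<s , s<α =
    let 0<s-r = subst (ℚ._< s ℚ.- r) (ℚ.+-inverseʳ r) (ℚ.+-monoˡ-< (ℚ.- r) r<s)
        n , 1≤n[s-r] = archimedean 0<s-r
    in separate-gap n r y α∈τ 0<s-r 1≤n[s-r]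
         (subst (_<ᴵ α y) (solve 2 (λ r s → s := r :+ (s :- r)) refl r s) s<α)

-- Truncated sums of finite families

sum : ∀ {x} {X : Set x} → List (𝕀^ X) → 𝕀^ X
sum = foldr _⊕_ 𝟎

⊕ᴵ-upperʳ : ∀ a b → b ≤ᴵ a ⊕ᴵ b
⊕ᴵ-upperʳ a b {p} p<b with rounded (value b) p<b
... | q , p<q , q<b =
  ( p ℚ.- q , q
  , 0≤ a (subst (p ℚ.- q ℚ.<_) (ℚ.+-inverseʳ q) (ℚ.+-monoˡ-< (ℚ.- q) p<q))
  , q<b , solve 2 (λ p q → p := (p :- q) :+ q) refl p q ) , ≤1 b p<b

module _ {x} {X : Set x} where

  sum-++-upperʳ : ∀ αs {βs : List (𝕀^ X)} a → sum βs a ≤ᴵ sum (αs ++ βs) a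
  sum-++-upperʳ []       a p = p
  sum-++-upperʳ (α ∷ αs) {βs} a p = ⊕ᴵ-upperʳ (α a) (sum (αs ++ βs) a) (sum-++-upperʳ αs a p)

  -- Each copy of `α` takes `p` off the target `q`; after `n` copies the target is negative, hence
  -- below any sum. Truncation does no harm as `q < 1`.
  sum-replicate : ∀ n (α : 𝕀^ X) βs a {p q} → 0ℚ ℚ.< p → p <ᴵ α a →
                  q ℚ.< 1ℚ → q ℚ.< n · p → q <ᴵ sum (replicate n α ++ βs) a
  sum-replicate zero    α βs a 0<p p<α q<1 q<0 = 0≤ (sum βs a) q<0
  sum-replicate (suc n) α βs a {p} {q} 0<p p<α q<1 q<np =
    ( p , q ℚ.- p , p<α
    , sum-replicate n α βs a 0<p p<α
        (ℚ.<-trans (subst (q ℚ.- p ℚ.<_) (ℚ.+-identityʳ q)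
                     (ℚ.+-monoʳ-< q (ℚ.neg-antimono-< 0<p))) q<1)
        (subst (q ℚ.- p ℚ.<_) (solve 2 (λ p n → (p :+ n) :- p := n) refl p (n · p))
          (ℚ.+-monoˡ-< (ℚ.- p) q<np))
    , solve 2 (λ p q → q := p :+ (q :- p)) refl p q ) , q<1

  sum-replicate≥1 : ∀ n (α : 𝕀^ X) βs a {p} → 0ℚ ℚ.< p → p <ᴵ α a → 1ℚ ℚ.≤ n · p →
                    1ᴵ ≤ᴵ sum (replicate n α ++ βs) a
  sum-replicate≥1 n α βs a 0<p p<α 1≤np q<1 = sum-replicate n α βs a 0<p p<α q<1 (ℚ.<-≤-trans q<1 1≤np)

-- The Teichmüller-Tukey lemma by way of a Zermelo tower

T-≡ : ∀ {a b} → (T a → T b) → (T b → T a) → a ≡ b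
T-≡ {false} {false} _ _ = refl
T-≡ {false} {true}  _ g = ⊥-elim (g tt)
T-≡ {true}  {false} f _ = ⊥-elim (f tt)
T-≡ {true}  {true}  _ _ = refl

module Classical (em : ∀ {ℓ} → ExcludedMiddle ℓ) (ext : ∀ {a b} → Extensionality a b) where

  by-contradiction : ∀ {p} {P : Set p} → ¬ ¬ P → P
  by-contradiction = decidable-stable em

  module Tukey {d n b} {D : Set d} (N : Pred D n) (Bad : Pred (List D) b) where

    -- A property of finite character: it is tested on finite lists only, so it passes to unions of
    -- chains.
    Consistent : ∀ {m} → Pred D m → Set (d ⊔ m ⊔ b)
    Consistent M = ∀ ds → All M ds → ¬ Bad ds

    -- Boolean subsets have a small type and, by function extensionality,
    -- extensional equality, so that a choice made from a subset depends on
    -- its elements only.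
    Subset : Set d
    Subset = D → Bool

    infix 4 _∋_ _⊑_

    _∋_ : Subset → Pred D 0ℓ
    S ∋ d = T (S d)

    _⊑_ : Subset → Subset → Set d
    S ⊑ S′ = ∀ d → S ∋ d → S′ ∋ d

    ⊑-antisym : ∀ {S S′} → S ⊑ S′ → S′ ⊑ S → S ≡ S′
    ⊑-antisym p q = ext λ d → T-≡ (p d) (q d)

    -- N is included so that the empty union is the least element of the tower.
    ⋃ : (Subset → Bool) → Subset
    ⋃ A d = ⌊ em {P = d ∈ N ⊎ ∃ λ S → T (A S) × S ∋ d} ⌋

    insert : Subset → D → Subset
    insert S d e = ⌊ em {P = S ∋ e ⊎ e ≡ d} ⌋

    Extension : Subset → Set (d ⊔ b)
    Extension S = ∃ λ d → ¬ (S ∋ d) × Consistent (insert S d ∋_)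

    -- Here `em` acts as the choice function: the witness `d` it returns is determined by `S`.
    next : Subset → Subset
    next S with em {P = Extension S}
    ... | yes (d , _) = insert S d
    ... | no _        = S

    -- The element chosen for a larger subset may differ, so monotonicity is claimed only for
    -- subsets that coincide.
    next-mono-≈ : ∀ {S S′} → S ⊑ S′ → S′ ⊑ S → next S ⊑ next S′
    next-mono-≈ {S} p q d = subst (λ S′ → next S′ ∋ d) (⊑-antisym p q)

    ⊑-next : ∀ S → S ⊑ next S
    ⊑-next S _ p with em {P = Extension S}
    ... | yes _ = fromWitness (inj₁ p)
    ... | no _  = p

    next-consistent : ∀ S → Consistent (S ∋_) → Consistent (next S ∋_)
    next-consistent S c with em {P = Extension S}
    ... | yes (_ , _ , c′) = c′
    ... | no _             = c

    next-fixed : ∀ S → next S ⊑ S → ¬ Extension S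
    next-fixed S fixed e with em {P = Extension S}
    ... | yes (d , d∉ , _) = d∉ (fixed d (fromWitness (inj₂ refl)))
    ... | no ¬e            = ¬e e

    -- The Zermelo–Bourbaki tower: its elements are pairwise comparable, so its
    -- union is again consistent and is fixed by next.
    data Tower : Pred Subset d where
      step : ∀ {S} → Tower S → Tower (next S)
      sup  : ∀ A → (∀ {S} → T (A S) → Tower S) → Tower (⋃ A)

    base : Subset
    base = ⋃ λ _ → false

    base-tower : Tower base
    base-tower = sup _ λ ()

    base∋ : ∀ {d} → d ∈ N → base ∋ d
    base∋ p = fromWitness (inj₁ p)

    ∋base : ∀ {d} → base ∋ d → d ∈ N
    ∋base p with toWitness p
    ... | inj₁ q = q

    N⊆tower : ∀ {S} → Tower S → ∀ {d} → d ∈ N → S ∋ d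
    N⊆tower (step {S} t) p = ⊑-next S _ (N⊆tower t p)
    N⊆tower (sup _ _)    p = fromWitness (inj₁ p)

    ⊑-⋃ : ∀ A {S} → T (A S) → S ⊑ ⋃ A
    ⊑-⋃ A a _ p = fromWitness (inj₂ (_ , a , p))

    ⋃-least : ∀ A {S} → Tower S → (∀ {S′} → T (A S′) → S′ ⊑ S) → ⋃ A ⊑ S
    ⋃-least A t bound _ p with toWitness p
    ... | inj₁ q           = N⊆tower t q
    ... | inj₂ (_ , a , q) = bound a _ q

    -- As for the extreme points of the Bourbaki-Witt theorem, the first alternative bounds
    -- `next S′` and not just `S′`; the `step` cases below rely on this.
    Comparable : Subset → Set d
    Comparable S = ∀ {S′} → Tower S′ → next S′ ⊑ S ⊎ S ⊑ S′

    -- Nothing in the tower fits strictly between `S` and `next S`: if `S′ ⊑ S`, then either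
    -- `next S′` is still below `S`, or `S′` equals `S` and both have the same successor.
    comparable-next : ∀ {S} → Tower S → Comparable S →
                      ∀ {S′} → Tower S′ → next S ⊑ S′ ⊎ S′ ⊑ S
    comparable-next {S} t c (step {S′} t′) with comparable-next t c t′
    ... | inj₁ p = inj₁ λ d q → ⊑-next S′ d (p d q)
    ... | inj₂ p with c t′
    ...   | inj₁ q = inj₂ q
    ...   | inj₂ q = inj₁ (next-mono-≈ q p)
    comparable-next {S} t c (sup A A⊆) with em {P = ∃ λ S′ → T (A S′) × next S ⊑ S′}
    ... | yes (_ , a , p) = inj₁ λ d q → ⊑-⋃ A a d (p d q)
    ... | no ¬p = inj₂ (⋃-least A t λ a →
            [ (λ q → ⊥-elim (¬p (_ , a , q))) , (λ q → q) ]′ (comparable-next t c (A⊆ a)))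

    comparable : ∀ {S} → Tower S → Comparable S
    comparable (step {S} t) {S′} t′ with comparable-next t (comparable t) t′
    ... | inj₁ p = inj₂ p
    ... | inj₂ p with comparable t t′
    ...   | inj₁ q = inj₁ λ d r → ⊑-next S d (q d r)
    ...   | inj₂ q = inj₁ (next-mono-≈ p q)
    comparable (sup A A⊆) {S′} t′ with em {P = ∃ λ S → T (A S) × next S′ ⊑ S}
    ... | yes (_ , a , p) = inj₁ λ d q → ⊑-⋃ A a d (p d q)
    ... | no ¬p = inj₂ (⋃-least A t′ λ a →
            [ (λ q → ⊥-elim (¬p (_ , a , q))) , (λ q → q) ]′ (comparable (A⊆ a) t′))

    tower-total : ∀ {S S′} → Tower S → Tower S′ → S′ ⊑ S ⊎ S ⊑ S′
    tower-total {S′ = S′} t t′ = [ (λ p → inj₁ λ d q → p d (⊑-next S′ d q)) , inj₂ ]′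
      (comparable t t′)

    module _ (N-consistent : Consistent N) where

      base-consistent : Consistent (base ∋_)
      base-consistent ds ds∈ = N-consistent ds (All.map ∋base ds∈)

      -- The tower is a chain, so the largest of finitely many members contains the whole list.
      finite-part : ∀ ds → All (λ d → ∃ λ S → Tower S × Consistent (S ∋_) × S ∋ d) ds →
                    ∃ λ S → Tower S × Consistent (S ∋_) × All (S ∋_) ds
      finite-part []       []       = base , base-tower , base-consistent , []
      finite-part (d ∷ ds) ((S , t , c , d∈) ∷ ps) with finite-part ds ps
      ... | S′ , t′ , c′ , ds∈ with tower-total t t′
      ...   | inj₁ p = S , t , c , d∈ ∷ All.map (p _) ds∈
      ...   | inj₂ p = S′ , t′ , c′ , p _ d∈ ∷ ds∈

      tower-consistent : ∀ {S} → Tower S → Consistent (S ∋_)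
      tower-consistent (step {S} t) = next-consistent S (tower-consistent t)
      tower-consistent (sup A A⊆) ds ds∈ with finite-part ds (All.map locate ds∈)
        where
        locate : ∀ {d} → ⋃ A ∋ d → ∃ λ S → Tower S × Consistent (S ∋_) × S ∋ d
        locate p with toWitness p
        ... | inj₁ q           = base , base-tower , base-consistent , base∋ q
        ... | inj₂ (S , a , q) = S , A⊆ a , tower-consistent (A⊆ a) , q
      ... | _ , _ , c , ds∈S = c ds ds∈S

      maximal-consistent : ∃ λ M → N ⊆ (M ∋_) × Consistent (M ∋_) ×
                           (∀ {d} → Consistent (insert M d ∋_) → M ∋ d)
      maximal-consistent = M , N⊆tower M-tower , tower-consistent M-tower , maximal
        where
        A : Subset → Bool
        A S = ⌊ em {P = Tower S} ⌋

        M : Subset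
        M = ⋃ A

        M-tower : Tower M
        M-tower = sup A toWitness

        maximal : ∀ {d} → Consistent (insert M d ∋_) → M ∋ d
        maximal c = by-contradiction λ d∉ →
          next-fixed M (⊑-⋃ A (fromWitness (step M-tower))) (_ , d∉ , c)

  -- Prime filters avoiding a family without finite subcover

  record IsPrimeFilter {x f} {X : Set x} (F : Pred (Pred X 0ℓ) f) : Set (x ⊔ f ⊔ lsuc 0ℓ) where
    field
      upward     : ∀ {A B} → A ⊆ B → A ∈ F → B ∈ F
      meets      : ∀ {A B} → A ∈ F → B ∈ F → A ∩ B ∈ F
      whole      : U ∈ F
      nontrivial : ∅ ∉ F
      prime      : ∀ {A B} → A ∪ B ∈ F → A ∈ F ⊎ B ∈ F

  Covers : ∀ {x} {X : Set x} → List (Pred X 0ℓ) → Set (lsuc 0ℓ ⊔ x)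
  Covers As = ∀ a → Any (a ∈_) As

  module _ {x n} {X : Set x} (N : Pred (Pred X 0ℓ) n)
           (N-noncovering : ∀ As → All N As → ¬ Covers As) where

    open Tukey N Covers

    opaque

      -- M is a maximal family without a finite subcover; F consists of the
      -- sets that together with finitely many members of M cover X.
      prime-filter-avoiding : ∃ λ (F : Pred (Pred X 0ℓ) (lsuc 0ℓ ⊔ x)) →
                              IsPrimeFilter F × (∀ {A} → A ∈ N → A ∉ F)
      prime-filter-avoiding with maximal-consistent N-noncovering
      ... | M , N⊆M , M-consistent , M-maximal = F , isPrimeFilter , λ A∈N → M-disjoint (N⊆M A∈N)
        where
        F : Pred (Pred X 0ℓ) (lsuc 0ℓ ⊔ x)
        F A = ∃ λ Bs → All (M ∋_) Bs × Covers (A ∷ Bs)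

        M-disjoint : ∀ {A} → M ∋ A → A ∉ F
        M-disjoint A∈M (Bs , Bs∈ , cov) = M-consistent (_ ∷ Bs) (A∈M ∷ Bs∈) cov

        -- All occurrences of `A` are merged into a single head entry, so a finite cover from
        -- `insert M A` witnesses `A ∈ F`.
        remove : ∀ {A} Cs → All (insert M A ∋_) Cs →
                 ∃ λ Bs → All (M ∋_) Bs × (∀ {a} → Any (a ∈_) Cs → Any (a ∈_) (A ∷ Bs))
        remove [] [] = [] , [] , λ ()
        remove (C ∷ Cs) (p ∷ ps) with remove Cs ps | toWitness p
        ... | Bs , Bs∈ , f | inj₁ C∈   = C ∷ Bs , C∈ ∷ Bs∈ , λ where
          (here q)  → there (here q)
          (there q) → [ here , (λ r → there (there r)) ]′ (Any.toSum (f q))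
        ... | Bs , Bs∈ , f | inj₂ refl = Bs , Bs∈ , λ where
          (here q)  → here q
          (there q) → f q

        ∉F⇒∈M : ∀ {A} → A ∉ F → M ∋ A
        ∉F⇒∈M A∉F = M-maximal λ Cs Cs∈ cov →
          let Bs , Bs∈ , f = remove Cs Cs∈ in A∉F (Bs , Bs∈ , λ a → f (cov a))

        isPrimeFilter : IsPrimeFilter F
        isPrimeFilter = record
          { upward = λ { A⊆B (Bs , Bs∈ , cov) → Bs , Bs∈ , λ a →
              [ (λ p → here (A⊆B p)) , there ]′ (Any.toSum (cov a)) }
          ; meets  = λ { (Bs , Bs∈ , cov) (Cs , Cs∈ , cov′) →
              Bs ++ Cs , All.++⁺ Bs∈ Cs∈ , λ a →
                [ (λ p → [ (λ q → here (p , q)) , (λ q → there (Any.++⁺ʳ Bs q)) ]′ (Any.toSum (cov′ a)))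
                , (λ p → there (Any.++⁺ˡ p)) ]′ (Any.toSum (cov a)) }
          ; whole  = [] , [] , λ _ → here tt
          ; nontrivial = λ { (Bs , Bs∈ , cov) → M-consistent Bs Bs∈ λ a →
              [ (λ ()) , (λ p → p) ]′ (Any.toSum (cov a)) }
          -- If neither set were in `F`, maximality would put both into `M`, where they form a
          -- finite cover together with `Cs`.
          ; prime  = λ { {A} {B} (Cs , Cs∈ , cov) → by-contradiction λ ¬AB →
              M-consistent (A ∷ B ∷ Cs)
                (∉F⇒∈M (λ A∈F → ¬AB (inj₁ A∈F)) ∷ ∉F⇒∈M (λ B∈F → ¬AB (inj₂ B∈F)) ∷ Cs∈)
                λ a → [ [ here , (λ p → there (here p)) ]′ , (λ p → there (there p)) ]′ (Any.toSum (cov a)) }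
          }

  -- Convergence of a prime filter in the factors and in the product

  -- If no member exceeds `p`, then `p` itself is an upper bound in the unit interval, against
  -- `p < s`. Negative `p` is set apart because it is no element of that interval and `S` may be
  -- empty.
  sup-approx : ∀ {g} {S : Pred 𝕀 g} {s p} → IsSup S s → p <ᴵ s →
               p ℚ.< 0ℚ ⊎ ∃ λ r → r ∈ S × p <ᴵ r
  sup-approx {S = S} {s} {p} (_ , least) p<s with p ℚ.<? 0ℚ
  ... | yes p<0 = inj₁ p<0
  ... | no p≮0 = inj₂ (by-contradiction λ ¬∃ →
          ℚ.<-irrefl refl (least p̂ (λ r r∈S {q} q<r →
            ℚ.≰⇒> λ p≤q → ¬∃ (r , r∈S , ≤-<ᴵ-trans r p≤q q<r)) p<s))
    where
    p̂ : 𝕀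
    p̂ = record { value = fromℚ p
               ; 0≤ = λ q<0 → ℚ.<-≤-trans q<0 (ℚ.≮⇒≥ p≮0)
               ; ≤1 = λ q<p → ℚ.<-trans q<p (≤1 s p<s) }

  module _ {i x t g f} {I : Set i} (X : I → MVTopologicalSpace x t g)
           {F : Pred (Pred (Point (Product X)) 0ℓ) f} (isPrimeFilter : IsPrimeFilter F) where

    open IsPrimeFilter isPrimeFilter

    module _ (j : I) where

      open MVTopologicalSpace (X j) using (isMVTopology; 𝟎-open; ⊕-open)

      Null : Pred (𝕀^ Point (X j)) (t ⊔ f)
      Null β = β ∈ Open (X j) × (λ a → 0ℚ <ᴵ β (a j)) ∉ F

      -- A truncated sum is positive only where some summand is, and `F` is prime.
      sum-null : ∀ {βs} → All Null βs → Null (sum βs)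
      sum-null [] = 𝟎-open , λ p → nontrivial (upward (ℚ.<-irrefl refl) p)
      sum-null {β ∷ βs} ((β-open , β∉F) ∷ ps) =
        let s-open , s∉F = sum-null ps in
        ⊕-open β-open s-open , λ p →
          [ β∉F , s∉F ]′ (prime (upward (λ {a} → positive-part (β (a j)) (sum βs (a j))) p))
        where
        positive-part : ∀ a b → 0ℚ <ᴵ a ⊕ᴵ b → 0ℚ <ᴵ a ⊎ 0ℚ <ᴵ b
        positive-part a b ((p , q , p<a , q<b , 0≡p+q) , _) with average p q (ℚ.≤-reflexive 0≡p+q)
        ... | inj₁ 0≤p = inj₁ (≤-<ᴵ-trans a 0≤p p<a)
        ... | inj₂ 0≤q = inj₂ (≤-<ᴵ-trans b 0≤q q<b)

      ConvergesTo : Point (X j) → Set (lsuc 0ℓ ⊔ x ⊔ t ⊔ f)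
      ConvergesTo y = ∀ {α} → α ∈ Open (X j) → ∀ r → r <ᴵ α y → (λ a → r <ᴵ α (a j)) ∈ F

      -- Failure of convergence gives an open `α` and a level `r` below `α y` whose superlevel set
      -- is not in `F`. Separation turns them into a null `β` positive at `y`, and enough copies of
      -- `β` add up to `1` there.
      null-approx : ∀ {y} → ¬ ConvergesTo y → ∀ {q} → q ℚ.< 1ℚ → ∃ λ β → Null β × q <ᴵ β y
      null-approx {y} ¬conv {q} q<1 = by-contradiction λ ¬∃ → ¬conv λ {α} α-open r r<αy →
        by-contradiction λ α∉F →
        let β , β-open , 0<β , sep = open-separation isMVTopology r y α-open r<αy
            p , 0<p , p<β = rounded (value (β y)) 0<β
            n , 1≤np = archimedean 0<p
            β-null = β-open , λ β∈F → α∉F (upward (λ {a} → sep (a j)) β∈F)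
        in ¬∃ (sum (replicate (suc n) β ++ []) , sum-null (All.++⁺ (All.replicate⁺ (suc n) β-null) []) ,
               sum-replicate≥1 (suc n) β [] y 0<p p<β 1≤np q<1)

      -- If `F` converged nowhere, the null opens would cover `X j`. Compactness would then make `𝟏`
      -- a sum of null opens, hence null, although its positivity set is the whole space.
      limit : Compact (X j) → ∃ ConvergesTo
      limit compact = by-contradiction no-limit
        where
        -- Null, moved by excluded middle into the universe Compact quantifies over.
        Γ : Pred (𝕀^ Point (X j)) g
        Γ β = Lift g (True (em {P = Null β}))

        Γ⊆Null : Γ ⊆ Null
        Γ⊆Null (lift p) = toWitness p

        covering : ¬ ∃ ConvergesTo → IsCovering Γ
        covering ¬lim y = (λ r _ → ≤1 r) , λ u bound q<1 →
          let β , β-null , q<β = null-approx (λ conv → ¬lim (y , conv)) q<1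
          in bound (β y) (β , lift (fromWitness β-null) , refl) q<β

        no-limit : ¬ ¬ ∃ ConvergesTo
        no-limit ¬lim =
          let βs , βs∈Γ , additive = compact Γ (proj₁ ∘ Γ⊆Null) (covering ¬lim)
          in proj₂ (sum-null (All.map Γ⊆Null βs∈Γ))
               (upward (λ {a} _ → proj₂ (additive (a j)) 0<1) whole)

    product-limit : ∀ {a} → (∀ j → ConvergesTo j (a j)) →
                    ∀ {o} → o ∈ Open (Product X) → ∀ r → r <ᴵ o a → (λ b → r <ᴵ o b) ∈ F
    product-limit conv (subbasic (j , α , α-open , refl)) r r<o = conv j α-open r r<o
    product-limit {a} conv (respects o≈o′ o-open) r r<o′ =
      upward (λ {b} → proj₁ (o≈o′ b)) (product-limit conv o-open r (proj₂ (o≈o′ a) r<o′))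
    product-limit conv zero r r<0 = upward (λ _ → r<0) whole
    product-limit conv one  r r<1 = upward (λ _ → r<1) whole
    product-limit {a} conv (join Γ Γ-open {o} o=⋁Γ) r r<o with sup-approx {s = o a} (o=⋁Γ a) r<o
    ... | inj₁ r<0 = upward (λ {b} _ → 0≤ (o b) r<0) whole
    ... | inj₂ (_ , (α , α∈Γ , refl) , r<α) =
      upward (λ {b} → proj₁ (o=⋁Γ b) (α b) (α , α∈Γ , refl)) (product-limit conv (Γ-open α∈Γ) r r<α)
    product-limit conv (times o₁-open o₂-open) r (inj₂ r<0) = upward (λ _ → inj₂ r<0) whole
    -- The rationals `p` and `q` that witness the inequality at the limit also witness it wherever
    -- `o₁` exceeds `p` and `o₂` exceeds `q`; the same works for `⊕`.
    product-limit conv (times o₁-open o₂-open) _ (inj₁ (_ , c , (p , q , p<o₁ , q<o₂ , refl) , c<-1 , refl)) =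
      upward (λ (p< , q<) → inj₁ (_ , c , (p , q , p< , q< , refl) , c<-1 , refl))
        (meets (product-limit conv o₁-open p p<o₁) (product-limit conv o₂-open q q<o₂))
    product-limit conv (plus o₁-open o₂-open) _ ((p , q , p<o₁ , q<o₂ , refl) , p+q<1) =
      upward (λ (p< , q<) → (p , q , p< , q< , refl) , p+q<1)
        (meets (product-limit conv o₁-open p p<o₁) (product-limit conv o₂-open q q<o₂))
    product-limit conv (meet o₁-open o₂-open) r (r<o₁ , r<o₂) =
      meets (product-limit conv o₁-open r r<o₁) (product-limit conv o₂-open r r<o₂)

  -- Superlevel sets and compactness of the product

  module _ {x g} {X : Set x} (Γ : Pred (𝕀^ X) g) where

    SuperlevelSet : Pred (Pred X 0ℓ) (lsuc 0ℓ ⊔ x ⊔ g)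
    SuperlevelSet A = ∃ λ α → α ∈ Γ × ∃ λ p → 0ℚ ℚ.< p × A ≡ (λ a → p <ᴵ α a)

    -- The bound is asked only on the union of `As`, so that the induction passes through families
    -- that do not cover.
    sum-on-superlevels : ∀ As → All SuperlevelSet As →
                         ∃ λ αs → All (_∈ Γ) αs × (∀ a → Any (a ∈_) As → 1ᴵ ≤ᴵ sum αs a)
    sum-on-superlevels [] [] = [] , [] , λ _ ()
    sum-on-superlevels (_ ∷ As) ((α , α∈Γ , p , 0<p , refl) ∷ ps) =
      let αs , αs∈Γ , bound = sum-on-superlevels As ps
          n , 1≤np = archimedean 0<p
      in replicate (suc n) α ++ αs , All.++⁺ (All.replicate⁺ (suc n) α∈Γ) αs∈Γ , λ where
           a (here p<α) → sum-replicate≥1 (suc n) α αs a 0<p p<α 1≤np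
           a (there q)  → λ r<1 → sum-++-upperʳ (replicate (suc n) α) a (bound a q r<1)

  module _ {i x t g f} {I : Set i} (X : I → MVTopologicalSpace x t g)
           {F : Pred (Pred (Point (Product X)) 0ℓ) f} (isPrimeFilter : IsPrimeFilter F) where

    noncovering : (∀ j → Compact (X j)) → ∀ {Γ : Pred (𝕀^ Point (Product X)) g} → Γ ⊆ Open (Product X) →
                  (∀ {A} → A ∈ SuperlevelSet Γ → A ∉ F) → ¬ IsCovering Γ
    noncovering compact {Γ} Γ-open avoids covering =
      contradict (sup-approx {s = 1ᴵ} (covering y) (toWitness {a? = ½ ℚ.<? 1ℚ} _))
      where
      lim : ∀ j → ∃ (ConvergesTo X isPrimeFilter j)
      lim j = limit X isPrimeFilter j (compact j)

      y : Point (Product X)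
      y j = proj₁ (lim j)

      contradict : ¬ (½ ℚ.< 0ℚ ⊎ ∃ λ r → (∃ λ α → α ∈ Γ × r ≡ α y) × ½ <ᴵ r)
      contradict (inj₁ (ℚ.*<* (ℤ.+<+ ())))
      contradict (inj₂ (_ , (α , α∈Γ , refl) , ½<α)) =
        avoids (α , α∈Γ , ½ , toWitness {a? = 0ℚ ℚ.<? ½} _ , refl)
          (product-limit X isPrimeFilter (λ j → proj₂ (lim j)) (Γ-open α∈Γ) ½ ½<α)

theorem5p3 : (∀ {ℓ} → ExcludedMiddle ℓ) →
    (∀ {a b} → Extensionality a b) →
    ∀ {i x t g} {I : Set i} (X : I → MVTopologicalSpace x t g) →
    (∀ j → Compact (X j)) →
    Compact (Product X)
theorem5p3 em ext X compact Γ Γ-open covering = by-contradiction λ ¬additive →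
  let F , isPrimeFilter , avoids = prime-filter-avoiding (SuperlevelSet Γ) λ As As∈ cov →
        let αs , αs∈Γ , bound = sum-on-superlevels Γ As As∈
        in ¬additive (αs , αs∈Γ , λ a → (λ {_} → ≤1 (sum αs a)) , (λ {_} → bound a (cov a)))
  in noncovering X isPrimeFilter compact Γ-open avoids covering
  where open Classical em ext
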